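{- Given an array $A$ of $n$ elements, the three phases of Spin-the-bottle sort run in $O(n^2\log n)$ time and sort $A$ with very high probability.
   Context: The elements of $A$ are distinct elements of a total order. Spin-the-bottle sort is the following randomized algorithm on an array $A[1..n]$. While $A$ is not sorted (in increasing order), perform a round: for $i=1,2,\ldots,n$ in order, choose $s$ uniformly and independently at random from $\{1,2,\ldots,i-1,i+1,\ldots,n\}$, and if ($i<s$ and $A[i]>A[s]$) or ($i>s$ and $A[i]<A[s]$), then swap $A[i]$ and $A[s]$. The running time is measured, up to constant factors, by the total number of compare-exchange operations performed (each round performs $n$ of them; the test for sortedness is a linear-time scan per round). Let $M_j$ be the number of inversions in $A$ at the beginning of round $j$ (an inversion is a pair of positions $a<b$ with $A[a]>A[b]$). The course of the algorithm is divided into three phases according to the value of $M_j$: Phase 1 when $M_j\ge 12 n\log n$; Phase 2 when $12n\le M_j<12n\log n$; Phase 3 when $M_j<12n$. An algorithm succeeds with very high probability if success occurs with probability $1-1/n^{\rho}$, for some constant $\rho\ge 1$. Here success means that all three phases complete, leaving $A$ sorted, within $O(n^2\log n)$ total time, the constants being independent of $n$ and of the input array $A$. -}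

module Defs where

open import Algebra.Properties.CommutativeMonoid.Sum using (sum)
open import Data.Bool.Base using (if_then_else_)
open import Data.Fin.Base as Fin using (Fin; punchIn)
import Data.Fin.Properties as Fin
open import Data.Fin.Permutation.Components using (transpose)
open import Data.Integer.Base using (+_)
open import Data.List.Base using (List; []; _∷_; allFin; cartesianProduct; filter; length)
open import Data.Nat.Base using (ℕ; zero; suc; _+_; _*_; _^_; _≤_; _<_; NonZero)
open import Data.Nat.Properties using (_≤?_; _<?_; m^n≢0)
open import Data.Product.Base using (_×_; _,_)
open import Data.Rational.Base as ℚ using (ℚ; 0ℚ; 1ℚ)
import Data.Rational.Properties as ℚ
open import Data.Sum.Base using (_⊎_)
open import Data.Vec.Functional using (Vector; rearrange)
open import Function.Definitions using (Injective)
open import Level using (Level)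
open import Relation.Binary.Bundles using (StrictTotalOrder)
open import Relation.Binary.Core using (_Preserves_⟶_)
open import Relation.Binary.PropositionalEquality.Core using (_≡_)
open import Relation.Nullary using (Dec; does)
open import Relation.Nullary.Decidable using (map′; _×-dec_; _⊎-dec_; _→-dec_)
open import Relation.Unary using (Pred; Decidable)

private variable
  a b p : Level

-- A randomized computation is the tree of its random choices.  `uniform k`
-- draws an element of the (k+1)-element set Fin (suc k), every element having
-- probability 1/(k+1), independently of all earlier draws.
data Rand (X : Set a) : Set a where
  return  : X → Rand X
  uniform : (k : ℕ) → (Fin (suc k) → Rand X) → Rand X

infixl 1 _>>=_

_>>=_ : {X : Set a} {Y : Set b} → Rand X → (X → Rand Y) → Rand Y
return x    >>= f = f x
uniform k c >>= f = uniform k (λ s → c s >>= f)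

Pr : {X : Set a} {P : Pred X p} → Decidable P → Rand X → ℚ
Pr P? (return x)    = if does (P? x) then 1ℚ else 0ℚ
Pr P? (uniform k c) =
  (+ 1 ℚ./ suc k) ℚ.* sum ℚ.+-0-commutativeMonoid (λ s → Pr P? (c s))

1/_^_ : (n : ℕ) → .{{NonZero n}} → ℕ → ℚ
1/ n ^ ρ = ℚ._/_ (+ 1) (n ^ ρ) {{m^n≢0 n ρ}}

data Phase : Set where
  phase₁ phase₂ phase₃ : Phase

-- With logarithms to base 2, 12 n log n ≤ M is the same as n^(12n) ≤ 2^M.
InPhase : (n : ℕ) → Phase → Pred ℕ _
InPhase n phase₁ M = n ^ (12 * n) ≤ 2 ^ M
InPhase n phase₂ M = 12 * n ≤ M × 2 ^ M < n ^ (12 * n)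
InPhase n phase₃ M = M < 12 * n

inPhase? : ∀ n ph → Decidable (InPhase n ph)
inPhase? n phase₁ M = n ^ (12 * n) ≤? 2 ^ M
inPhase? n phase₂ M = (12 * n ≤? M) ×-dec (2 ^ M <? n ^ (12 * n))
inPhase? n phase₃ M = M <? 12 * n

-- The algorithm on arrays of length n = 2 + m.  The length is at least 2
-- because otherwise there is no index s ≠ i to be drawn.
module SpinTheBottle {c ℓ₁ ℓ₂} (O : StrictTotalOrder c ℓ₁ ℓ₂) (m : ℕ) where

  open StrictTotalOrder O using (Carrier; _≈_)
    renaming (_<_ to _≺_; _<?_ to _≺?_)

  n : ℕ
  n = 2 + m

  Array : Set c
  Array = Vector Carrier n

  Distinct : Pred Array _
  Distinct A = Injective _≡_ _≈_ A

  Sorted : Pred Array _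
  Sorted A = A Preserves Fin._<_ ⟶ _≺_

  sorted? : Decidable Sorted
  sorted? A = map′ (λ f {i} {j} → f i j) (λ f i j → f {i} {j})
    (Fin.all? λ i → Fin.all? λ j → (i Fin.<? j) →-dec (A i ≺? A j))

  Inversion : Array → Pred (Fin n × Fin n) _
  Inversion A (i , j) = i Fin.< j × A j ≺ A i

  inversion? : (A : Array) → Decidable (Inversion A)
  inversion? A (i , j) = (i Fin.<? j) ×-dec (A j ≺? A i)

  inversions : Array → ℕ
  inversions A = length (filter (inversion? A) (cartesianProduct (allFin n) (allFin n)))

  OutOfOrder : Array → Fin n → Fin n → Set _
  OutOfOrder A i s = (i Fin.< s × A s ≺ A i) ⊎ (s Fin.< i × A i ≺ A s)

  outOfOrder? : ∀ A i s → Dec (OutOfOrder A i s)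
  outOfOrder? A i s =
    ((i Fin.<? s) ×-dec (A s ≺? A i)) ⊎-dec ((s Fin.<? i) ×-dec (A i ≺? A s))

  compareExchange : Fin n → Fin n → Array → Array
  compareExchange i s A =
    if does (outOfOrder? A i s) then rearrange (transpose i s) A else A

  -- `punchIn i` is a bijection from Fin (1 + m) onto the indices other than i.
  spins : List (Fin n) → Array → Rand Array
  spins []       A = return A
  spins (i ∷ is) A = uniform m λ k → spins is (compareExchange i (punchIn i k) A)

  round : Array → Rand Array
  round = spins (allFin n)

  -- `starts` lists the array at the beginning of each round performed.
  record Execution : Set c where
    constructor execution
    field
      starts : List Array
      final  : Array

  open Execution public

  -- The while loop, interrupted if it has not stopped after the given number
  -- of rounds.
  spinTheBottle : ℕ → Array → Rand Execution
  spinTheBottle zero    A = return (execution [] A)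
  spinTheBottle (suc r) A =
    if does (sorted? A)
    then return (execution [] A)
    else (round A >>= λ B → spinTheBottle r B >>= λ e →
          return (execution (A ∷ starts e) (final e)))

  -- Number of compare-exchange operations performed during a phase.
  phaseTime : Phase → Execution → ℕ
  phaseTime ph e =
    n * length (filter (λ A → inPhase? n ph (inversions A)) (starts e))

  totalTime : Execution → ℕ
  totalTime e = phaseTime phase₁ e + phaseTime phase₂ e + phaseTime phase₃ e

  Success : ℕ → Pred Execution _
  Success T e = Sorted (final e) × totalTime e ≤ T

  success? : ∀ T → Decidable (Success T)
  success? T e = sorted? (final e) ×-dec (totalTime e ≤? T)

  -- The probability that the unbounded while loop stops, with the array
  -- sorted, within time T.  A round takes time n ≥ 1, so interrupting the loop
  -- after T rounds does not affect this event.
  successProbability : ℕ → Array → ℚ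
  successProbability T A = Pr (success? T) (spinTheBottle T A)

{-# OPTIONS --safe #-}
-- Let e(j) be the number of inversions (j , s) and M the sum of all e(j).  The spin at i
-- lowers M in expectation by at least e(i)/(n - 1).  An exchange of i and s raises no
-- other e(j), and it lowers them together by less than it lowers M.  So the e(j) of the
-- indices still to come shrink only by what M has lost and, with probability 1/(n - 1)
-- each, because s = j.  Over a round this contracts the expected M by the factor
-- 1 - 1/(12n), in whichever phase.  As M ≤ n² at the start, Markov's inequality bounds
-- the probability that inversions remain after 72 n log n rounds by 1/n.
module Submission where

open import Defs
open import Algebra.Bundles using (CommutativeRing)
open import Data.Bool.Base using (true; false; if_then_else_)
open import Data.Fin.Base as Fin using (Fin; zero; suc; punchIn; punchOut)
import Data.Fin.Properties as Fin
open import Data.Fin.Permutation.Components using (transpose; transpose-inverse)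
import Data.Integer.Base as ℤ
import Data.Integer.Properties as ℤ
open import Data.List.Base as List using (List; []; _∷_; _++_; allFin; cartesianProduct; filter; length)
import Data.List.Properties as List
open import Data.List.Membership.Propositional using (_∈_; _∉_)
open import Data.List.Membership.Propositional.Properties using (∈-allFin)
open import Data.List.Relation.Unary.All as All using ()
open import Data.List.Relation.Unary.AllPairs using ([]; _∷_)
open import Data.List.Relation.Unary.Any using (here; there)
open import Data.List.Relation.Unary.Unique.Propositional using (Unique)
open import Data.List.Relation.Unary.Unique.Propositional.Properties using (allFin⁺; Unique[x∷xs]⇒x∉xs)
open import Data.Nat.Base using (ℕ; zero; suc; pred; _+_; _*_; _^_; _≤_; z≤n; s≤s; NonZero)
open import Data.Nat.Logarithm using (⌊log₂_⌋; ⌊log₂⌋-mono-≤; ⌊log₂[2^n]⌋≡n)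
import Data.Nat.Properties as ℕ
open import Data.Nat.Tactic.RingSolver using (solve-∀)
open import Data.Product.Base using (_×_; ∃-syntax; _,_; proj₁; proj₂)
open import Data.Rational.Base as ℚ using (ℚ; 0ℚ; 1ℚ; Positive; NonNegative)
import Data.Rational.Properties as ℚ
import Data.Rational.Unnormalised.Base as ℚᵘ
import Data.Rational.Unnormalised.Properties as ℚᵘ
open import Data.Sum.Base using (inj₁; inj₂)
open import Data.Vec.Functional using (Vector; rearrange; removeAt)
open import Function.Base using (_∘_)
open import Level using (Level)
open import Relation.Binary.Bundles using (StrictTotalOrder)
open import Relation.Binary.Definitions using (tri<; tri≈; tri>)
open import Relation.Binary.PropositionalEquality
open import Relation.Nullary using (¬_; Dec; yes; no; does; contradiction)
open import Relation.Nullary.Decidable using (_×-dec_; dec-true; dec-false)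
open import Relation.Unary using (Pred; Decidable)
open import Algebra.Properties.Semiring.Sum ℕ.+-*-semiring
  using (sum; ∑-distrib-+; sum-remove; *-distribˡ-sum; sum-cong-≗)
import Algebra.Properties.Semiring.Mult (CommutativeRing.semiring ℚ.+-*-commutativeRing) as ×
import Algebra.Properties.Semiring.Sum (CommutativeRing.semiring ℚ.+-*-commutativeRing) as Σℚ

-- The gains e(i)/(n - 1) cannot be added up from the array at the start of a round, because earlier
-- exchanges alter the e(j) of later indices. The induction therefore carries both quantities. With
-- n = m + 2, if k spins are still to come and E is the sum of the e(j) over their indices, then the
-- expected M at the end of the round is at most M - (m/(m+1))^k E/n. Each spin costs one factor
-- m/(m+1), the chance that `s` misses a given other index, while inversions lost from E in any
-- other way are paid for by the fall of M. At the start of a round k = n and E = M, and (m/(m+1))^n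
-- ≥ 1/12 for m ≥ 1 is the origin of the 12. For m = 0 this factor vanishes, so two elements need
-- their own argument.
--
-- All of this is done in natural numbers: expectations become totals over the equally likely
-- outcomes. The rationals enter only through `Bound`, in which denominators are cleared. Its
-- failure bound is linear in M, so it can be averaged through the spins without a general notion of
-- expectation.

private variable
  a b p q u v : Level
  P : Set p
  Q : Set q
  U : Set u
  V : Set v
  k : ℕ

-- Finite sums of natural numbers

sum-mono : {f g : Vector ℕ k} → (∀ i → f i ≤ g i) → sum f ≤ sum g
sum-mono {zero}  f≤g = z≤n
sum-mono {suc k} f≤g = ℕ.+-mono-≤ (f≤g zero) (sum-mono (f≤g ∘ suc))

sum-const : ∀ k x → sum {k} (λ _ → x) ≡ k * x
sum-const zero    x = refl
sum-const (suc k) x = cong (x +_) (sum-const k x)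

sum-≤ : (f : Vector ℕ k) (c : ℕ) → (∀ i → f i ≤ c) → sum f ≤ k * c
sum-≤ {k} f c f≤c = ℕ.≤-trans (sum-mono f≤c) (ℕ.≤-reflexive (sum-const k c))

term≤sum : (f : Vector ℕ k) (i : Fin k) → f i ≤ sum f
term≤sum f zero    = ℕ.m≤m+n _ _
term≤sum f (suc i) = ℕ.≤-trans (term≤sum (f ∘ suc) i) (ℕ.m≤n+m _ _)

sum-remove₂ : (f : Vector ℕ (2 + k)) {i j : Fin (2 + k)} (i≢j : i ≢ j) →
  sum f ≡ f i + f j + sum (removeAt (removeAt f i) (punchOut i≢j))
sum-remove₂ f {i} {j} i≢j = begin
  sum f                            ≡⟨ sum-remove {i = i} f ⟩
  f i + sum (removeAt f i)         ≡⟨ cong (f i +_) (sum-remove {i = punchOut i≢j} (removeAt f i)) ⟩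
  f i + (f (punchIn i (punchOut i≢j)) + rest)  ≡⟨ cong (λ l → f i + (f l + rest)) (Fin.punchIn-punchOut i≢j) ⟩
  f i + (f j + rest)               ≡⟨ ℕ.+-assoc (f i) (f j) rest ⟨
  f i + f j + rest                 ∎
  where
  open ≡-Reasoning
  rest = sum (removeAt (removeAt f i) (punchOut i≢j))

-- An exchange controls its own two positions only jointly, since one of the two terms may rise;
-- everywhere else the comparison is termwise.
sum-mono₂ : ∀ c d {f g : Vector ℕ (2 + k)} {i j} → i ≢ j →
  (∀ l → l ≢ i → l ≢ j → f l ≤ g l) →
  f i + f j + c ≤ g i + g j + d → sum f + c ≤ sum g + d
sum-mono₂ c d {f} {g} {i} {j} i≢j others both
  rewrite sum-remove₂ f i≢j | sum-remove₂ g i≢j = begin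
  f i + f j + rest f + c   ≡⟨ comm (f i + f j) (rest f) c ⟩
  f i + f j + c + rest f   ≤⟨ ℕ.+-mono-≤ both (sum-mono λ l → others _ (≢i l) (≢j l)) ⟩
  g i + g j + d + rest g   ≡⟨ comm (g i + g j) d (rest g) ⟩
  g i + g j + rest g + d   ∎
  where
  open ℕ.≤-Reasoning
  rest : Vector ℕ _ → ℕ
  rest h = sum (removeAt (removeAt h i) (punchOut i≢j))
  comm : ∀ x y z → x + y + z ≡ x + z + y
  comm = solve-∀
  ≢i : ∀ l → punchIn i (punchIn (punchOut i≢j) l) ≢ i
  ≢i l = Fin.punchInᵢ≢i i _
  ≢j : ∀ l → punchIn i (punchIn (punchOut i≢j) l) ≢ j
  ≢j l eq = Fin.punchInᵢ≢i (punchOut i≢j) l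
    (Fin.punchIn-injective i _ _ (trans eq (sym (Fin.punchIn-punchOut i≢j))))

-- Indicators and counting

𝟙 : Dec P → ℕ
𝟙 P? = if does P? then 1 else 0

𝟙-yes : (P? : Dec P) → P → 𝟙 P? ≡ 1
𝟙-yes P? p rewrite dec-true P? p = refl

𝟙-no : (P? : Dec P) → ¬ P → 𝟙 P? ≡ 0
𝟙-no P? ¬p rewrite dec-false P? ¬p = refl

𝟙≤1 : (P? : Dec P) → 𝟙 P? ≤ 1
𝟙≤1 (yes _) = ℕ.≤-refl
𝟙≤1 (no  _) = z≤n

-- For 0/1 values the difference of the two sides is (Q - P)(V - U), a product of nonnegative
-- factors. In its uses `P`, `Q` compare positions and `U`, `V` compare elements.
𝟙-rearrangement : (P? : Dec P) (Q? : Dec Q) (U? : Dec U) (V? : Dec V) →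
  (P → Q) → (U → V) →
  𝟙 (P? ×-dec V?) + 𝟙 (Q? ×-dec U?) ≤ 𝟙 (P? ×-dec U?) + 𝟙 (Q? ×-dec V?)
𝟙-rearrangement (yes p) (no ¬q) _       _       P⇒Q _   = contradiction (P⇒Q p) ¬q
𝟙-rearrangement _       _       (yes u) (no ¬v) _   U⇒V = contradiction (U⇒V u) ¬v
𝟙-rearrangement (yes _) (yes _) U?      V?      _   _   = ℕ.≤-reflexive (ℕ.+-comm (𝟙 V?) (𝟙 U?))
𝟙-rearrangement (no _)  (no _)  _       _       _   _   = z≤n
𝟙-rearrangement (no _)  (yes _) (no _)  _       _   _   = z≤n
𝟙-rearrangement (no _)  (yes _) (yes _) (yes _) _   _   = ℕ.≤-refl

if-elim : {X : Set a} (P? : Dec P) {x y : X} (R : X → Set q) →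
  (P → R x) → (¬ P → R y) → R (if does P? then x else y)
if-elim (yes p) R Rx Ry = Rx p
if-elim (no ¬p) R Rx Ry = Ry ¬p

module _ {X : Set a} {P : Pred X p} (P? : Decidable P) where

  length-filter-∷ : ∀ x xs → length (filter P? (x ∷ xs)) ≡ 𝟙 (P? x) + length (filter P? xs)
  length-filter-∷ x xs with P? x
  ... | yes _ = refl
  ... | no  _ = refl

  length-filter-tabulate : (f : Fin k → X) →
    length (filter P? (List.tabulate f)) ≡ sum (𝟙 ∘ P? ∘ f)
  length-filter-tabulate {zero}  f = refl
  length-filter-tabulate {suc k} f = trans (length-filter-∷ (f zero) _)
    (cong (𝟙 (P? (f zero)) +_) (length-filter-tabulate (f ∘ suc)))

length-filter-cartesianProduct : {X : Set a} {Y : Set b} {P : Pred (X × Y) p}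
  (P? : Decidable P) {k l : ℕ} (f : Fin k → X) (g : Fin l → Y) →
  length (filter P? (cartesianProduct (List.tabulate f) (List.tabulate g))) ≡
  sum (λ i → sum (λ j → 𝟙 (P? (f i , g j))))
length-filter-cartesianProduct P? {zero}  f g = refl
length-filter-cartesianProduct P? {suc k} f g = begin
  length (filter P? (List.map (f zero ,_) gs ++ rest))
    ≡⟨ cong length (List.filter-++ P? (List.map (f zero ,_) gs) rest) ⟩
  length (filter P? (List.map (f zero ,_) gs) ++ filter P? rest)
    ≡⟨ List.length-++ (filter P? (List.map (f zero ,_) gs)) ⟩
  length (filter P? (List.map (f zero ,_) gs)) + length (filter P? rest)
    ≡⟨ cong₂ _+_ row (length-filter-cartesianProduct P? (f ∘ suc) g) ⟩
  sum (λ i → sum (λ j → 𝟙 (P? (f i , g j))))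
    ∎
  where
  open ≡-Reasoning
  gs   = List.tabulate g
  rest = cartesianProduct (List.tabulate (f ∘ suc)) gs
  row  = trans (cong (length ∘ filter P?) (List.map-tabulate g (f zero ,_)))
               (length-filter-tabulate P? (λ j → f zero , g j))

-- Transpositions and sums over the indices still to come

transpose-matchˡ : (i j : Fin k) → transpose i j i ≡ j
transpose-matchˡ i j rewrite dec-true (i Fin.≟ i) refl = refl

transpose-matchʳ : {i j : Fin k} → i ≢ j → transpose i j j ≡ i
transpose-matchʳ {i = i} {j} i≢j
  rewrite dec-false (j Fin.≟ i) (i≢j ∘ sym) | dec-true (j Fin.≟ j) refl = refl

transpose-minimal : {i j l : Fin k} → l ≢ i → l ≢ j → transpose i j l ≡ l
transpose-minimal {i = i} {j} {l} l≢i l≢j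
  rewrite dec-false (l Fin.≟ i) l≢i | dec-false (l Fin.≟ j) l≢j = refl

-- Membership as a weight on all of `Fin k` makes the share of the listed indices a sum over the
-- same range as M, so that the two can be compared term by term.
indicator : List (Fin k) → Fin k → ℕ
indicator []       j = 0
indicator (i ∷ is) j = if does (i Fin.≟ j) then 1 else indicator is j

indicator≤1 : (is : List (Fin k)) → ∀ j → indicator is j ≤ 1
indicator≤1 []       j = z≤n
indicator≤1 (i ∷ is) j with i Fin.≟ j
... | yes _ = ℕ.≤-refl
... | no  _ = indicator≤1 is j

indicator-∉ : {is : List (Fin k)} {j : Fin k} → j ∉ is → indicator is j ≡ 0
indicator-∉ {is = []}     j∉ = refl
indicator-∉ {is = i ∷ is} {j} j∉ with i Fin.≟ j
... | yes i≡j = contradiction (here (sym i≡j)) j∉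
... | no  _   = indicator-∉ (j∉ ∘ there)

indicator-∈ : {is : List (Fin k)} {j : Fin k} → j ∈ is → indicator is j ≡ 1
indicator-∈ {is = i ∷ is} {j} j∈ with i Fin.≟ j
indicator-∈ j∈          | yes _   = refl
indicator-∈ (here j≡i)  | no  i≢j = contradiction (sym j≡i) i≢j
indicator-∈ (there j∈)  | no  _   = indicator-∈ j∈

weigh : List (Fin k) → Vector ℕ k → ℕ
weigh is f = sum (λ j → indicator is j * f j)

weigh-∷ : (i : Fin (suc k)) (is : List (Fin (suc k))) (f : Vector ℕ (suc k)) →
  weigh (i ∷ is) f ≤ f i + weigh is f
weigh-∷ i is f = begin
  weigh (i ∷ is) f
    ≡⟨ sum-remove {i = i} (λ j → indicator (i ∷ is) j * f j) ⟩
  indicator (i ∷ is) i * f i + sum (λ t → indicator (i ∷ is) (punchIn i t) * f (punchIn i t))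
    ≤⟨ ℕ.+-mono-≤ (ℕ.*-monoˡ-≤ (f i) (indicator≤1 (i ∷ is) i)) (ℕ.≤-reflexive (sum-cong-≗ away)) ⟩
  1 * f i + sum (λ t → indicator is (punchIn i t) * f (punchIn i t))
    ≤⟨ ℕ.+-mono-≤ (ℕ.≤-reflexive (ℕ.*-identityˡ (f i))) (ℕ.m≤n+m _ (indicator is i * f i)) ⟩
  f i + (indicator is i * f i + sum (λ t → indicator is (punchIn i t) * f (punchIn i t)))
    ≡⟨ cong (f i +_) (sum-remove {i = i} (λ j → indicator is j * f j)) ⟨
  f i + weigh is f
    ∎
  where
  open ℕ.≤-Reasoning
  away : ∀ t → indicator (i ∷ is) (punchIn i t) * f (punchIn i t) ≡ indicator is (punchIn i t) * f (punchIn i t)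
  away t rewrite dec-false (i Fin.≟ punchIn i t) (Fin.punchInᵢ≢i i t ∘ sym) = refl

-- Numerical estimates

-- (1 + 1/m)^k ≤ 1 + k/m + (k/m)², multiplied by m^(k + 2).
[1+m]^k-bound : ∀ m k → k ≤ m → suc m ^ k * (m * m) ≤ m ^ k * (m * m + k * m + k * k)
[1+m]^k-bound m zero    _   = ℕ.≤-reflexive (lem (m * m))
  where
  lem : ∀ x → 1 * x ≡ 1 * (x + 0 + 0)
  lem = solve-∀
[1+m]^k-bound m (suc k) k<m = begin
  suc m * suc m ^ k * (m * m)
    ≡⟨ ℕ.*-assoc (suc m) (suc m ^ k) (m * m) ⟩
  suc m * (suc m ^ k * (m * m))
    ≤⟨ ℕ.*-monoʳ-≤ (suc m) ([1+m]^k-bound m k (ℕ.<⇒≤ k<m)) ⟩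
  suc m * (m ^ k * (m * m + k * m + k * k))
    ≡⟨ regroup₁ m k (m ^ k) ⟩
  m ^ k * (m * (m * m + k * m + k * k) + m * m + k * m + k * k)
    -- Here `k ≤ m` turns the excess term k² into km, which the next square (k + 1)² m has room for.
    ≤⟨ ℕ.*-monoʳ-≤ (m ^ k) (ℕ.+-monoʳ-≤ _ (ℕ.*-monoʳ-≤ k (ℕ.<⇒≤ k<m))) ⟩
  m ^ k * (m * (m * m + k * m + k * k) + m * m + k * m + k * m)
    ≤⟨ ℕ.*-monoʳ-≤ (m ^ k) (ℕ.m≤m+n _ m) ⟩
  m ^ k * (m * (m * m + k * m + k * k) + m * m + k * m + k * m + m)
    ≡⟨ regroup₂ m k (m ^ k) ⟩
  m * m ^ k * (m * m + suc k * m + suc k * suc k)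
    ∎
  where
  open ℕ.≤-Reasoning
  regroup₁ : ∀ m k z → suc m * (z * (m * m + k * m + k * k)) ≡
             z * (m * (m * m + k * m + k * k) + m * m + k * m + k * k)
  regroup₁ = solve-∀
  regroup₂ : ∀ m k z → z * (m * (m * m + k * m + k * k) + m * m + k * m + k * m + m) ≡
             m * z * (m * m + suc k * m + suc k * suc k)
  regroup₂ = solve-∀

[1+m]^m≤3*m^m : ∀ m .{{_ : NonZero m}} → suc m ^ m ≤ 3 * m ^ m
[1+m]^m≤3*m^m m = ℕ.*-cancelʳ-≤ _ _ (m * m) {{ℕ.m*n≢0 m m}} (begin
  suc m ^ m * (m * m)                    ≤⟨ [1+m]^k-bound m m ℕ.≤-refl ⟩
  m ^ m * (m * m + m * m + m * m)        ≡⟨ lem (m ^ m) (m * m) ⟩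
  3 * m ^ m * (m * m)                    ∎)
  where
  open ℕ.≤-Reasoning
  lem : ∀ x y → x * (y + y + y) ≡ 3 * x * y
  lem = solve-∀

-- The constant is 2 · 2 · 3: (1 + 1/m)^m is at most 3, and each of the two extra factors 1 + 1/m is
-- at most 2.
[1+m]^[2+m]≤12*m^[2+m] : ∀ m .{{_ : NonZero m}} → suc m ^ (2 + m) ≤ 12 * m ^ (2 + m)
[1+m]^[2+m]≤12*m^[2+m] m@(suc j) = begin
  suc m * (suc m * suc m ^ m)                ≤⟨ ℕ.*-mono-≤ 1+m≤2m (ℕ.*-mono-≤ 1+m≤2m ([1+m]^m≤3*m^m m)) ⟩
  2 * m * (2 * m * (3 * m ^ m))              ≡⟨ lem m (m ^ m) ⟩
  12 * (m * (m * m ^ m))                     ∎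
  where
  open ℕ.≤-Reasoning
  1+m≤2m : suc m ≤ 2 * m
  1+m≤2m = s≤s (subst (suc j ≤_) (sym (ℕ.+-suc j (j + 0))) (s≤s (ℕ.m≤m+n j _)))
  lem : ∀ x y → 2 * x * (2 * x * (3 * y)) ≡ 12 * (x * (x * y))
  lem = solve-∀

-- Bernoulli's inequality (1 + 1/d)^k ≥ 1 + k/d with denominators cleared.
bernoulli : ∀ d k → d ^ k * (d + k) ≤ suc d ^ k * d
bernoulli d zero    = ℕ.≤-reflexive (cong (1 *_) (ℕ.+-identityʳ d))
bernoulli d (suc k) = begin
  d * d ^ k * (d + suc k)                        ≤⟨ ℕ.m≤m+n _ (d ^ k * k) ⟩
  d * d ^ k * (d + suc k) + d ^ k * k            ≡⟨ lem d k (d ^ k) ⟩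
  suc d * (d ^ k * (d + k))                      ≤⟨ ℕ.*-monoʳ-≤ (suc d) (bernoulli d k) ⟩
  suc d * (suc d ^ k * d)                        ≡⟨ ℕ.*-assoc (suc d) (suc d ^ k) d ⟨
  suc d * suc d ^ k * d                          ∎
  where
  open ℕ.≤-Reasoning
  lem : ∀ d k z → d * z * (d + suc k) + z * k ≡ suc d * (z * (d + k))
  lem = solve-∀

-- In the form (1 - 1/D)^D ≤ 1/2 with D = d + 1: if each round contracts by 1 - 1/D, then D rounds
-- halve.
d^[1+d]*2≤[1+d]^[1+d] : ∀ d .{{_ : NonZero d}} → d ^ suc d * 2 ≤ suc d ^ suc d
d^[1+d]*2≤[1+d]^[1+d] d = ℕ.*-cancelʳ-≤ _ _ d (begin
  d ^ suc d * 2 * d              ≡⟨ lem d (d ^ suc d) ⟩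
  d ^ suc d * (d + d)            ≤⟨ ℕ.*-monoʳ-≤ (d ^ suc d) (ℕ.+-monoʳ-≤ d (ℕ.n≤1+n d)) ⟩
  d ^ suc d * (d + suc d)        ≤⟨ bernoulli d (suc d) ⟩
  suc d ^ suc d * d              ∎)
  where
  open ℕ.≤-Reasoning
  lem : ∀ x y → y * 2 * x ≡ y * (x + x)
  lem = solve-∀

n<2^[1+⌊log₂n⌋] : ∀ n → suc n ≤ 2 ^ suc ⌊log₂ n ⌋
n<2^[1+⌊log₂n⌋] n = ℕ.≰⇒> λ 2^≤n → ℕ.<-irrefl refl
  (subst (_≤ ⌊log₂ n ⌋) (⌊log₂[2^n]⌋≡n (suc ⌊log₂ n ⌋)) (⌊log₂⌋-mono-≤ 2^≤n))

-- Accounting for a single spin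

-- One outcome of a spin with N alternatives.  Primes mark the array after the exchange,
-- W the total over the spins still to come, E the part of M due to their indices, and
-- l the part that s takes out of E.
spin-step : ∀ N q p M′ M x W E E′ l → p ≤ q →
  suc N * W + p * E′ ≤ suc N * (q * M′) → M′ + x ≤ M → E + M′ ≤ E′ + M + l →
  suc N * W + (p * E + N * q * x) ≤ suc N * (q * M) + p * l
spin-step N q p M′ M x W E E′ l p≤q IH drop loss
  with d , refl ← ℕ.m≤n⇒∃[o]m+o≡n (ℕ.≤-trans (ℕ.m≤m+n M′ x) drop) = begin
  suc N * W + (p * E + N * q * x)
    ≤⟨ ℕ.+-monoʳ-≤ (suc N * W) (ℕ.+-mono-≤ (ℕ.*-monoʳ-≤ p E≤) (ℕ.*-monoʳ-≤ (N * q) x≤d)) ⟩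
  suc N * W + (p * (E′ + d + l) + N * q * d)
    ≡⟨ regroup₁ N q p W E′ d l ⟩
  (suc N * W + p * E′) + (p * d + N * q * d) + p * l
    -- `d` is the fall of M. Of the `suc N` shares `q * d` that it is worth, one covers the `p * d`
    -- missing from E and the other `N` become the gain.
    ≤⟨ ℕ.+-monoˡ-≤ (p * l) (ℕ.+-mono-≤ IH (ℕ.+-monoˡ-≤ (N * q * d) (ℕ.*-monoˡ-≤ d p≤q))) ⟩
  suc N * (q * M′) + (q * d + N * q * d) + p * l
    ≡⟨ regroup₂ N q p M′ d l ⟩
  suc N * (q * (M′ + d)) + p * l
    ∎
  where
  open ℕ.≤-Reasoning
  x≤d : x ≤ d
  x≤d = ℕ.+-cancelˡ-≤ M′ x d drop
  swap : ∀ E′ M′ d l → E′ + (M′ + d) + l ≡ M′ + (E′ + d + l)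
  swap = solve-∀
  E≤ : E ≤ E′ + d + l
  E≤ = ℕ.+-cancelˡ-≤ M′ E (E′ + d + l) (subst₂ _≤_ (ℕ.+-comm E M′) (swap E′ M′ d l) loss)
  regroup₁ : ∀ N q p W E′ d l → suc N * W + (p * (E′ + d + l) + N * q * d) ≡
             (suc N * W + p * E′) + (p * d + N * q * d) + p * l
  regroup₁ = solve-∀
  regroup₂ : ∀ N q p M′ d l → suc N * (q * M′) + (q * d + N * q * d) + p * l ≡
             suc N * (q * (M′ + d)) + p * l
  regroup₂ = solve-∀

-- Summed over the `suc m` outcomes, the losses `l` amount to at most one copy of E, because each
-- other index is drawn in exactly one outcome. Of the `suc m` copies of `p * E`, `m` remain, which
-- supplies the next power of `m`.
spin-step-total : ∀ m q p M W E E⁺ x → p ≤ q → E⁺ ≤ x + E →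
  suc (suc m) * W + (suc m * (p * E) + suc m * q * x) ≤ suc m * (suc (suc m) * (q * M)) + p * E →
  suc (suc m) * W + m * p * E⁺ ≤ suc (suc m) * (suc m * q * M)
spin-step-total m q p M W E E⁺ x p≤q E⁺≤ summed = ℕ.+-cancelʳ-≤ (p * E) _ _ (begin
  suc (suc m) * W + m * p * E⁺ + p * E
    ≤⟨ ℕ.+-monoˡ-≤ (p * E) (ℕ.+-monoʳ-≤ (suc (suc m) * W) (ℕ.*-monoʳ-≤ (m * p) E⁺≤)) ⟩
  suc (suc m) * W + m * p * (x + E) + p * E
    ≡⟨ regroup₁ m p W E x ⟩
  suc (suc m) * W + (suc m * (p * E) + m * p * x)
    ≤⟨ ℕ.+-monoʳ-≤ (suc (suc m) * W) (ℕ.+-monoʳ-≤ (suc m * (p * E))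
         (ℕ.*-monoˡ-≤ x (ℕ.*-mono-≤ (ℕ.n≤1+n m) p≤q))) ⟩
  suc (suc m) * W + (suc m * (p * E) + suc m * q * x)
    ≤⟨ summed ⟩
  suc m * (suc (suc m) * (q * M)) + p * E
    ≡⟨ cong (_+ p * E) (regroup₂ m q M) ⟩
  suc (suc m) * (suc m * q * M) + p * E
    ∎)
  where
  open ℕ.≤-Reasoning
  regroup₁ : ∀ m p W E x → suc (suc m) * W + m * p * (x + E) + p * E ≡
             suc (suc m) * W + (suc m * (p * E) + m * p * x)
  regroup₁ = solve-∀
  regroup₂ : ∀ m q M → suc m * (suc (suc m) * (q * M)) ≡ suc (suc m) * (suc m * q * M)
  regroup₂ = solve-∀

-- Inversions under exchanges and over a round

module Inversions {c ℓ₁ ℓ₂} (O : StrictTotalOrder c ℓ₁ ℓ₂) (m : ℕ) where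

  open SpinTheBottle O m
  open StrictTotalOrder O using (compare)
    renaming (_<_ to _≺_; _<?_ to _≺?_; asym to ≺-asym; trans to ≺-trans)

  -- An inversion is counted at its left position only, so that these numbers add up to M exactly.
  inversionsAt : Array → Fin n → ℕ
  inversionsAt A j = sum (λ s → 𝟙 (inversion? A (j , s)))

  inversions≡sum : ∀ A → inversions A ≡ sum (inversionsAt A)
  inversions≡sum A = length-filter-cartesianProduct (inversion? A) (λ i → i) (λ j → j)

  inversions≤n*n : ∀ A → inversions A ≤ n * n
  inversions≤n*n A = ℕ.≤-trans (ℕ.≤-reflexive (inversions≡sum A))
    (sum-≤ (inversionsAt A) n λ j →
      ℕ.≤-trans (sum-≤ (λ s → 𝟙 (inversion? A (j , s))) 1 λ s → 𝟙≤1 (inversion? A (j , s)))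
                (ℕ.≤-reflexive (ℕ.*-identityʳ n)))

  inversion⇒0<inversions : ∀ A {i j} → Inversion A (i , j) → 1 ≤ inversions A
  inversion⇒0<inversions A {i} {j} inv = begin
    1                       ≡⟨ 𝟙-yes (inversion? A (i , j)) inv ⟨
    𝟙 (inversion? A (i , j)) ≤⟨ term≤sum (λ s → 𝟙 (inversion? A (i , s))) j ⟩
    inversionsAt A i        ≤⟨ term≤sum (inversionsAt A) i ⟩
    sum (inversionsAt A)    ≡⟨ inversions≡sum A ⟨
    inversions A            ∎
    where open ℕ.≤-Reasoning

  unsorted⇒0<inversions : ∀ A → Distinct A → ¬ Sorted A → 1 ≤ inversions A
  unsorted⇒0<inversions A distinct unsorted = ℕ.≰⇒> λ M≤0 → unsorted λ {i} {j} i<j →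
    sorted M≤0 i<j
    where
    sorted : inversions A ≤ 0 → ∀ {i j} → i Fin.< j → A i ≺ A j
    sorted M≤0 {i} {j} i<j with compare (A i) (A j)
    ... | tri< lt _ _ = lt
    ... | tri≈ _ eq _ = contradiction (distinct eq) (Fin.<⇒≢ i<j)
    ... | tri> _ _ gt = contradiction (ℕ.≤-trans (inversion⇒0<inversions A (i<j , gt)) M≤0) λ ()

  compareExchange-distinct : ∀ i s A → Distinct A → Distinct (compareExchange i s A)
  compareExchange-distinct i s A distinct with does (outOfOrder? A i s)
  ... | false = distinct
  ... | true  = λ eq → trans (sym (transpose-inverse s i))
        (trans (cong (transpose s i) (distinct eq)) (transpose-inverse s i))

  -- `B` is given by its values and not as a transposition, so that the spun index can play the role
  -- of `i` as well as that of `j`.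
  module Exchange (A B : Array) {i j} (i<j : i Fin.< j) (Aj≺Ai : A j ≺ A i)
    (Bi≡ : B i ≡ A j) (Bj≡ : B j ≡ A i) (B≡ : ∀ l → l ≢ i → l ≢ j → B l ≡ A l) where

    i≢j : i ≢ j
    i≢j = Fin.<⇒≢ i<j

    inversionsAt-other : ∀ l → l ≢ i → l ≢ j → inversionsAt B l ≤ inversionsAt A l
    inversionsAt-other l l≢i l≢j =
      subst₂ _≤_ (ℕ.+-identityʳ _) (ℕ.+-identityʳ _) (sum-mono₂ 0 0 i≢j elsewhere (ℕ.+-monoˡ-≤ 0 both))
      where
      elsewhere : ∀ s → s ≢ i → s ≢ j → 𝟙 (inversion? B (l , s)) ≤ 𝟙 (inversion? A (l , s))
      elsewhere s s≢i s≢j rewrite B≡ l l≢i l≢j | B≡ s s≢i s≢j = ℕ.≤-refl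
      both : 𝟙 (inversion? B (l , i)) + 𝟙 (inversion? B (l , j)) ≤ 𝟙 (inversion? A (l , i)) + 𝟙 (inversion? A (l , j))
      both rewrite B≡ l l≢i l≢j | Bi≡ | Bj≡ =
        𝟙-rearrangement (l Fin.<? i) (l Fin.<? j) (A i ≺? A l) (A j ≺? A l)
          (λ l<i → Fin.<-trans l<i i<j) (≺-trans Aj≺Ai)

    -- The count at `j` may rise, as the larger element moves there, but the counts at `i` and `j`
    -- together obey the rearrangement inequality at every third position. The inversion `(i , j)`
    -- itself disappears, whence the 1.
    inversionsAt-pair : inversionsAt B i + inversionsAt B j + 1 ≤ inversionsAt A i + inversionsAt A j
    inversionsAt-pair = begin
      inversionsAt B i + inversionsAt B j + 1
        ≡⟨ cong (_+ 1) (∑-distrib-+ (λ s → 𝟙 (inversion? B (i , s))) (λ s → 𝟙 (inversion? B (j , s)))) ⟨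
      sum (pair B) + 1
        ≤⟨ sum-mono₂ 1 0 i≢j elsewhere both ⟩
      sum (pair A) + 0
        ≡⟨ ℕ.+-identityʳ _ ⟩
      sum (pair A)
        ≡⟨ ∑-distrib-+ (λ s → 𝟙 (inversion? A (i , s))) (λ s → 𝟙 (inversion? A (j , s))) ⟩
      inversionsAt A i + inversionsAt A j
        ∎
      where
      open ℕ.≤-Reasoning
      pair : Array → Fin n → ℕ
      pair Z s = 𝟙 (inversion? Z (i , s)) + 𝟙 (inversion? Z (j , s))
      elsewhere : ∀ s → s ≢ i → s ≢ j → pair B s ≤ pair A s
      elsewhere s s≢i s≢j rewrite B≡ s s≢i s≢j | Bi≡ | Bj≡ =
        subst₂ _≤_ (ℕ.+-comm (𝟙 (j Fin.<? s ×-dec A s ≺? A i)) _) (ℕ.+-comm (𝟙 (j Fin.<? s ×-dec A s ≺? A j)) _)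
          (𝟙-rearrangement (j Fin.<? s) (i Fin.<? s) (A s ≺? A j) (A s ≺? A i)
            (Fin.<-trans i<j) (λ lt → ≺-trans lt Aj≺Ai))
      both : pair B i + pair B j + 1 ≤ pair A i + pair A j + 0
      both = begin
        pair B i + pair B j + 1
          ≡⟨ cong (_+ 1) (cong₂ _+_
               (cong₂ _+_ (𝟙-no (inversion? B (i , i)) (λ inv → Fin.<-irrefl refl (proj₁ inv)))
                          (𝟙-no (inversion? B (j , i)) (λ inv → Fin.<-asym i<j (proj₁ inv))))
               (cong₂ _+_ (𝟙-no (inversion? B (i , j)) (λ inv → ≺-asym Aj≺Ai (subst₂ _≺_ Bj≡ Bi≡ (proj₂ inv))))
                          (𝟙-no (inversion? B (j , j)) (λ inv → Fin.<-irrefl refl (proj₁ inv))))) ⟩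
        1
          ≡⟨ 𝟙-yes (inversion? A (i , j)) (i<j , Aj≺Ai) ⟨
        𝟙 (inversion? A (i , j))
          ≤⟨ ℕ.m≤m+n _ _ ⟩
        pair A j
          ≤⟨ ℕ.m≤n+m _ (pair A i) ⟩
        pair A i + pair A j
          ≡⟨ ℕ.+-identityʳ _ ⟨
        pair A i + pair A j + 0
          ∎

    inversions-exchange : inversions B + 1 ≤ inversions A
    inversions-exchange rewrite inversions≡sum A | inversions≡sum B =
      ℕ.≤-trans (sum-mono₂ 1 0 i≢j inversionsAt-other (ℕ.≤-trans inversionsAt-pair (ℕ.m≤m+n _ 0)))
                (ℕ.≤-reflexive (ℕ.+-identityʳ _))

    -- Away from `i` and `j` every count falls or stays, so a weight of at most 1 keeps its fall
    -- within its share of the fall of M. At `i` and `j` no separate comparison is available, and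
    -- their weighted counts are given up entirely.
    weigh-exchange : ∀ is →
      weigh is (inversionsAt A) + inversions B ≤
      weigh is (inversionsAt B) + inversions A +
        (indicator is i * inversionsAt A i + indicator is j * inversionsAt A j)
    weigh-exchange is rewrite inversions≡sum A | inversions≡sum B =
      subst₂ _≤_
        (trans (ℕ.+-identityʳ _) (∑-distrib-+ (λ l → w l * eA l) eB))
        (cong (_+ (w i * eA i + w j * eA j)) (∑-distrib-+ (λ l → w l * eB l) eA))
        (sum-mono₂ 0 (w i * eA i + w j * eA j) i≢j elsewhere both)
      where
      w  = indicator is
      eA = inversionsAt A
      eB = inversionsAt B
      bounded : ∀ {x y z} → x ≤ 1 → y ≤ z → x * z + y ≤ x * y + z
      bounded {zero}        _         y≤z = y≤z
      bounded {suc zero} {y} {z} _    y≤z = ℕ.≤-reflexive (comm y z)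
        where
        comm : ∀ y z → 1 * z + y ≡ 1 * y + z
        comm = solve-∀
      bounded {suc (suc _)} (s≤s ())
      elsewhere : ∀ l → l ≢ i → l ≢ j → w l * eA l + eB l ≤ w l * eB l + eA l
      elsewhere l l≢i l≢j = bounded (indicator≤1 is l) (inversionsAt-other l l≢i l≢j)
      both : (w i * eA i + eB i) + (w j * eA j + eB j) + 0 ≤
             (w i * eB i + eA i) + (w j * eB j + eA j) + (w i * eA i + w j * eA j)
      both = begin
        (w i * eA i + eB i) + (w j * eA j + eB j) + 0
          ≡⟨ regroup₁ (w i * eA i) (eB i) (w j * eA j) (eB j) ⟩
        (eB i + eB j) + (w i * eA i + w j * eA j)
          ≤⟨ ℕ.+-monoˡ-≤ _ (ℕ.≤-trans (ℕ.m≤m+n _ 1) inversionsAt-pair) ⟩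
        (eA i + eA j) + (w i * eA i + w j * eA j)
          ≤⟨ ℕ.m≤n+m _ (w i * eB i + w j * eB j) ⟩
        (w i * eB i + w j * eB j) + ((eA i + eA j) + (w i * eA i + w j * eA j))
          ≡⟨ regroup₂ (w i * eB i) (w j * eB j) (eA i) (eA j) (w i * eA i + w j * eA j) ⟩
        (w i * eB i + eA i) + (w j * eB j + eA j) + (w i * eA i + w j * eA j)
          ∎
        where
        open ℕ.≤-Reasoning
        regroup₁ : ∀ p q r s → (p + q) + (r + s) + 0 ≡ (q + s) + (p + r)
        regroup₁ = solve-∀
        regroup₂ : ∀ p q r s t → (p + q) + ((r + s) + t) ≡ (p + r) + (q + s) + t
        regroup₂ = solve-∀

  -- Because of `i ∉ is` the spun index has weight 0, so of the two counts given up in an exchange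
  -- only the one at `s` is charged.
  compareExchange-progress : ∀ A i s is → i ≢ s → i ∉ is → let B = compareExchange i s A in
    inversions B + 𝟙 (inversion? A (i , s)) ≤ inversions A ×
    weigh is (inversionsAt A) + inversions B ≤
    weigh is (inversionsAt B) + inversions A + indicator is s * inversionsAt A s
  compareExchange-progress A i s is i≢s i∉is = if-elim (outOfOrder? A i s) Progress exchanged unchanged
    where
    A′ = rearrange (transpose i s) A
    Progress : Array → Set
    Progress B =
      inversions B + 𝟙 (inversion? A (i , s)) ≤ inversions A ×
      weigh is (inversionsAt A) + inversions B ≤
      weigh is (inversionsAt B) + inversions A + indicator is s * inversionsAt A s
    unchanged : ¬ OutOfOrder A i s → Progress A
    unchanged ok =
      ℕ.≤-reflexive (trans (cong (inversions A +_) (𝟙-no (inversion? A (i , s)) (ok ∘ inj₁))) (ℕ.+-identityʳ _)) ,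
      ℕ.m≤m+n _ _
    lost  = indicator is s * inversionsAt A s
    bound = weigh is (inversionsAt A′) + inversions A
    settled : indicator is i * inversionsAt A i ≡ 0
    settled = cong (_* inversionsAt A i) (indicator-∉ i∉is)
    exchanged : OutOfOrder A i s → Progress A′
    exchanged (inj₁ (i<s , As≺Ai)) =
      ℕ.≤-trans (ℕ.+-monoʳ-≤ _ (𝟙≤1 (inversion? A (i , s)))) inversions-exchange ,
      ℕ.≤-trans (weigh-exchange is) (ℕ.≤-reflexive (cong (λ z → bound + (z + lost)) settled))
      where open Exchange A A′ i<s As≺Ai
              (cong A (transpose-matchˡ i s)) (cong A (transpose-matchʳ i≢s))
              (λ l l≢i l≢s → cong A (transpose-minimal l≢i l≢s))
    exchanged (inj₂ (s<i , Ai≺As)) =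
      ℕ.≤-trans (ℕ.+-monoʳ-≤ _ (𝟙≤1 (inversion? A (i , s)))) inversions-exchange ,
      ℕ.≤-trans (weigh-exchange is) (ℕ.≤-reflexive
        (trans (cong (λ z → bound + (lost + z)) settled) (cong (bound +_) (ℕ.+-identityʳ lost))))
      where open Exchange A A′ s<i Ai≺As
              (cong A (transpose-matchʳ i≢s)) (cong A (transpose-matchˡ i s))
              (λ l l≢s l≢i → cong A (transpose-minimal l≢i l≢s))

  -- Summing over all outcomes avoids fractions: the expectation is this total
  -- divided by (1 + m) ^ length is.
  totalInversions : List (Fin n) → Array → ℕ
  totalInversions []       A = inversions A
  totalInversions (i ∷ is) A = sum (λ t → totalInversions is (compareExchange i (punchIn i t) A))

  -- Division by `n * suc m ^ length is` turns this into a statement about the expected number of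
  -- inversions. Uniqueness provides that the index being spun is not among those still to come.
  totalInversions-drop : ∀ is → Unique is → ∀ A →
    n * totalInversions is A + m ^ length is * weigh is (inversionsAt A) ≤
    n * (suc m ^ length is * inversions A)
  totalInversions-drop [] _ A rewrite sum-const n 0 = ℕ.≤-reflexive (lem n (inversions A))
    where
    lem : ∀ n M → n * M + 1 * (n * 0) ≡ n * (1 * M)
    lem = solve-∀
  totalInversions-drop (i ∷ is) unique@(_ ∷ unique′) A =
    spin-step-total m (suc m ^ length is) (m ^ length is) (inversions A) (totalInversions (i ∷ is) A)
      (weigh is e) (weigh (i ∷ is) e) (e i) (ℕ.^-monoˡ-≤ (length is) (ℕ.n≤1+n m)) (weigh-∷ i is e) summed
    where
    open ℕ.≤-Reasoning
    e = inversionsAt A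
    mᵏ = m ^ length is
    Nᵏ = suc m ^ length is
    W = λ t → totalInversions is (compareExchange i (punchIn i t) A)
    x = λ t → 𝟙 (inversion? A (i , punchIn i t))
    l = λ t → indicator is (punchIn i t) * e (punchIn i t)
    spin : ∀ t → n * W t + (mᵏ * weigh is e + suc m * Nᵏ * x t) ≤ n * (Nᵏ * inversions A) + mᵏ * l t
    spin t = spin-step (suc m) Nᵏ mᵏ _ (inversions A) (x t) (W t) (weigh is e) _ (l t)
      (ℕ.^-monoˡ-≤ (length is) (ℕ.n≤1+n m))
      (totalInversions-drop is unique′ (compareExchange i (punchIn i t) A))
      (proj₁ progress) (proj₂ progress)
      where progress = compareExchange-progress A i (punchIn i t) is
                         (Fin.punchInᵢ≢i i t ∘ sym) (Unique[x∷xs]⇒x∉xs unique)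
    Σx : sum x ≡ e i
    Σx = sym (trans (sum-remove {i = i} (λ s → 𝟙 (inversion? A (i , s))))
      (cong (_+ sum x) (𝟙-no (inversion? A (i , i)) (λ inv → Fin.<-irrefl refl (proj₁ inv)))))
    Σl : sum l ≤ weigh is e
    Σl = ℕ.≤-trans (ℕ.m≤n+m (sum l) (indicator is i * e i)) (ℕ.≤-reflexive (sym (sum-remove {i = i} (λ s → indicator is s * e s))))
    summed : n * sum W + (suc m * (mᵏ * weigh is e) + suc m * Nᵏ * e i) ≤
             suc m * (n * (Nᵏ * inversions A)) + mᵏ * weigh is e
    summed = begin
      n * sum W + (suc m * (mᵏ * weigh is e) + suc m * Nᵏ * e i)
        ≡⟨ cong₂ _+_ (*-distribˡ-sum n W) (cong₂ _+_ (sym (sum-const (suc m) _))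
             (trans (cong (suc m * Nᵏ *_) (sym Σx)) (*-distribˡ-sum (suc m * Nᵏ) x))) ⟩
      sum (λ t → n * W t) + (sum {suc m} (λ _ → mᵏ * weigh is e) + sum (λ t → suc m * Nᵏ * x t))
        ≡⟨ cong (sum (λ t → n * W t) +_) (∑-distrib-+ (λ _ → mᵏ * weigh is e) (λ t → suc m * Nᵏ * x t)) ⟨
      sum (λ t → n * W t) + sum (λ t → mᵏ * weigh is e + suc m * Nᵏ * x t)
        ≡⟨ ∑-distrib-+ (λ t → n * W t) (λ t → mᵏ * weigh is e + suc m * Nᵏ * x t) ⟨
      sum (λ t → n * W t + (mᵏ * weigh is e + suc m * Nᵏ * x t))
        ≤⟨ sum-mono spin ⟩
      sum (λ t → n * (Nᵏ * inversions A) + mᵏ * l t)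
        ≡⟨ ∑-distrib-+ (λ _ → n * (Nᵏ * inversions A)) (λ t → mᵏ * l t) ⟩
      sum {suc m} (λ _ → n * (Nᵏ * inversions A)) + sum (λ t → mᵏ * l t)
        ≡⟨ cong₂ _+_ (sum-const (suc m) _) (sym (*-distribˡ-sum mᵏ l)) ⟩
      suc m * (n * (Nᵏ * inversions A)) + mᵏ * sum l
        ≤⟨ ℕ.+-monoʳ-≤ (suc m * (n * (Nᵏ * inversions A))) (ℕ.*-monoʳ-≤ mᵏ Σl) ⟩
      suc m * (n * (Nᵏ * inversions A)) + mᵏ * weigh is e
        ∎

  weigh-allFin : ∀ f → weigh (allFin n) f ≡ sum f
  weigh-allFin f = sum-cong-≗ λ j → trans (cong (_* f j) (indicator-∈ (∈-allFin j))) (ℕ.*-identityˡ (f j))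

  round-drop : ∀ A →
    n * totalInversions (allFin n) A + m ^ n * inversions A ≤ n * (suc m ^ n * inversions A)
  round-drop A =
    subst₂ (λ l E → n * totalInversions (allFin n) A + m ^ l * E ≤ n * (suc m ^ l * inversions A))
      (List.length-tabulate {n = n} (λ i → i)) (trans (weigh-allFin (inversionsAt A)) (sym (inversions≡sum A)))
      (totalInversions-drop (allFin n) (allFin⁺ n) A)

-- Contraction over a round

vacuous-contraction : ∀ D {W} x .{{_ : NonZero D}} → W ≡ 0 → D * W + x ≤ D * x
vacuous-contraction D x refl rewrite ℕ.*-zeroʳ D = ℕ.m≤n*m x D

drop⇒≤ : ∀ n W y M .{{_ : NonZero n}} → n * W + y ≤ n * M → W ≤ M
drop⇒≤ n W y M drop = ℕ.*-cancelˡ-≤ n (ℕ.≤-trans (ℕ.m≤m+n (n * W) y) drop)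

contraction : ∀ n W M q p → q ≤ 12 * p → n * W + p * M ≤ n * (q * M) →
  12 * n * W + q * M ≤ 12 * n * (q * M)
contraction n W M q p q≤12p drop = begin
  12 * n * W + q * M       ≤⟨ ℕ.+-monoʳ-≤ (12 * n * W) (ℕ.*-monoˡ-≤ M q≤12p) ⟩
  12 * n * W + 12 * p * M  ≡⟨ regroup 12 n W p M ⟩
  12 * (n * W + p * M)     ≤⟨ ℕ.*-monoʳ-≤ 12 drop ⟩
  12 * (n * (q * M))       ≡⟨ ℕ.*-assoc 12 n (q * M) ⟨
  12 * n * (q * M)         ∎
  where
  open ℕ.≤-Reasoning
  regroup : ∀ c n W x M → c * n * W + c * x * M ≡ c * (n * W + x * M)
  regroup = solve-∀

module _ {c ℓ₁ ℓ₂} (O : StrictTotalOrder c ℓ₁ ℓ₂) where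

  -- For m = 0 the bound of `round-drop` is void, but the very first spin sorts.
  round-drop₂ : let open SpinTheBottle O 0 in let open Inversions O 0 in
    ∀ A → totalInversions (allFin n) A ≡ 0
  round-drop₂ A = ℕ.n≤0⇒n≡0 (begin
    totalInversions (allFin n) A
      ≡⟨ ℕ.+-identityʳ (totalInversions (suc zero ∷ []) B) ⟩
    totalInversions (suc zero ∷ []) B
      -- The second spin does not raise the total, so it suffices that the first leaves no
      -- inversion.
      ≤⟨ drop⇒≤ 2 (totalInversions (suc zero ∷ []) B) (0 ^ 1 * weigh (suc zero ∷ []) (inversionsAt B))
           (1 ^ 1 * inversions B) (totalInversions-drop (suc zero ∷ []) (All.[] ∷ []) B) ⟩
    1 ^ 1 * inversions B
      ≡⟨ ℕ.*-identityˡ (inversions B) ⟩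
    inversions B
      ≤⟨ ℕ.+-cancelʳ-≤ (𝟙 (inversion? A (zero , suc zero))) (inversions B) 0
           (ℕ.≤-trans (proj₁ (compareExchange-progress A zero (suc zero) [] (λ ()) (λ ())))
                      (ℕ.≤-reflexive single)) ⟩
    0 ∎)
    where
    open ℕ.≤-Reasoning
    open SpinTheBottle O 0
    open Inversions O 0
    B = compareExchange zero (suc zero) A
    x = 𝟙 (inversion? A (zero , suc zero))
    single : inversions A ≡ 𝟙 (inversion? A (zero , suc zero))
    single = trans (inversions≡sum A)
      (trans (ℕ.+-identityʳ (x + 0)) (ℕ.+-identityʳ x))

  round-contraction : ∀ m → let open SpinTheBottle O m in let open Inversions O m in
    ∀ A → 12 * n * totalInversions (allFin n) A + suc m ^ n * inversions A ≤
          12 * n * (suc m ^ n * inversions A)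
  round-contraction zero A =
    vacuous-contraction (12 * SpinTheBottle.n O 0)
      (suc 0 ^ SpinTheBottle.n O 0 * SpinTheBottle.inversions O 0 A) (round-drop₂ A)
  round-contraction m@(suc _) A =
    contraction n (totalInversions (allFin n) A) (inversions A) (suc m ^ n) (m ^ n)
      ([1+m]^[2+m]≤12*m^[2+m] m) (round-drop A)
    where
    open SpinTheBottle O m
    open Inversions O m

-- Natural numbers as rationals

ι : ℕ → ℚ
ι k = k ×.× 1ℚ

ι-+ : ∀ x y → ι (x + y) ≡ ι x ℚ.+ ι y
ι-+ = ×.×-homo-+ 1ℚ

ι-* : ∀ x y → ι (x * y) ≡ ι x ℚ.* ι y
ι-* = ×.×1-homo-*

ι-sum : (f : Vector ℕ k) → Σℚ.sum (ι ∘ f) ≡ ι (sum f)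
ι-sum {zero}  f = refl
ι-sum {suc k} f = trans (cong (ι (f zero) ℚ.+_) (ι-sum (f ∘ suc))) (sym (ι-+ (f zero) _))

ι-nonNeg : ∀ x → NonNegative (ι x)
ι-nonNeg zero    = _
ι-nonNeg (suc x) = ℚ.nonNeg+nonNeg⇒nonNeg 1ℚ (ι x) {{ι-nonNeg x}}

ι-pos : ∀ x → Positive (ι (suc x))
ι-pos x = ℚ.pos+nonNeg⇒pos 1ℚ (ι x) {{ι-nonNeg x}}

ι-mono : ∀ {x y} → x ≤ y → ι x ℚ.≤ ι y
ι-mono {x} x≤y with d , refl ← ℕ.m≤n⇒∃[o]m+o≡n x≤y = begin
  ι x            ≡⟨ ℚ.+-identityʳ (ι x) ⟨
  ι x ℚ.+ 0ℚ     ≤⟨ ℚ.+-monoʳ-≤ (ι x) (ℚ.nonNegative⁻¹ (ι d) {{ι-nonNeg d}}) ⟩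
  ι x ℚ.+ ι d    ≡⟨ ι-+ x d ⟨
  ι (x + d)      ∎
  where open ℚ.≤-Reasoning

1/[1+_] : ℕ → ℚ
1/[1+ k ] = ℤ.+ 1 ℚ./ suc k

1/-nonNeg : ∀ k → NonNegative 1/[1+ k ]
1/-nonNeg k = ℚ.normalize-nonNeg 1 (suc k)

-- `1/[1+ k ]` is a normalised fraction, while `ι` is a repeated sum; among unnormalised rationals
-- their product can be checked by computing numerators.
toℚᵘ-ι : ∀ k → ℚ.toℚᵘ (ι k) ℚᵘ.≃ ℚᵘ.mkℚᵘ (ℤ.+ k) 0
toℚᵘ-ι zero    = ℚᵘ.≃-refl
toℚᵘ-ι (suc k) = begin
  ℚ.toℚᵘ (1ℚ ℚ.+ ι k)                  ≈⟨ ℚ.toℚᵘ-homo-+ 1ℚ (ι k) ⟩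
  ℚᵘ.1ℚᵘ ℚᵘ.+ ℚ.toℚᵘ (ι k)             ≈⟨ ℚᵘ.+-congʳ ℚᵘ.1ℚᵘ (toℚᵘ-ι k) ⟩
  ℚᵘ.1ℚᵘ ℚᵘ.+ ℚᵘ.mkℚᵘ (ℤ.+ k) 0        ≈⟨ ℚᵘ.*≡* (lem k) ⟩
  ℚᵘ.mkℚᵘ (ℤ.+ suc k) 0                ∎
  where
  open ℚᵘ.≃-Reasoning
  lem : ∀ k → (ℤ.+ 1 ℤ.* ℤ.+ 1 ℤ.+ ℤ.+ k ℤ.* ℤ.+ 1) ℤ.* ℤ.+ 1 ≡ ℤ.+ suc k ℤ.* ℤ.+ 1
  lem k rewrite ℤ.*-identityʳ (ℤ.+ k) = refl

ι-inverse : ∀ k → ι (suc k) ℚ.* 1/[1+ k ] ≡ 1ℚ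
ι-inverse k = ℚ.toℚᵘ-injective (begin
  ℚ.toℚᵘ (ι (suc k) ℚ.* 1/[1+ k ])                 ≈⟨ ℚ.toℚᵘ-homo-* (ι (suc k)) 1/[1+ k ] ⟩
  ℚ.toℚᵘ (ι (suc k)) ℚᵘ.* ℚ.toℚᵘ 1/[1+ k ]         ≈⟨ ℚᵘ.*-cong (toℚᵘ-ι (suc k)) (ℚ.toℚᵘ-fromℚᵘ (ℚᵘ.mkℚᵘ (ℤ.+ 1) k)) ⟩
  ℚᵘ.mkℚᵘ (ℤ.+ suc k) 0 ℚᵘ.* ℚᵘ.mkℚᵘ (ℤ.+ 1) k     ≈⟨ ℚᵘ.*≡* (lem k) ⟩
  ℚᵘ.1ℚᵘ                                           ∎)
  where
  open ℚᵘ.≃-Reasoning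
  lem : ∀ k → (ℤ.+ suc k ℤ.* ℤ.+ 1) ℤ.* ℤ.+ 1 ≡ ℤ.+ 1 ℤ.* ℤ.+ (1 * suc k)
  lem k = cong (λ x → ℤ.+ suc x) (ones k)
    where
    ones : ∀ k → k * 1 * 1 ≡ k + 0 + 0
    ones = solve-∀

-- Probabilities

sumℚ-mono : {f g : Vector ℚ k} → (∀ i → f i ℚ.≤ g i) → Σℚ.sum f ℚ.≤ Σℚ.sum g
sumℚ-mono {zero}  f≤g = ℚ.≤-refl
sumℚ-mono {suc k} f≤g = ℚ.+-mono-≤ (f≤g zero) (sumℚ-mono (f≤g ∘ suc))

Pr-nonneg : {X : Set a} {P : Pred X p} (P? : Decidable P) (r : Rand X) → 0ℚ ℚ.≤ Pr P? r
Pr-nonneg P? (return x) with does (P? x)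
... | true  = ℚ.nonNegative⁻¹ 1ℚ
... | false = ℚ.≤-refl
Pr-nonneg P? (uniform k c) = begin
  0ℚ                                        ≡⟨ ℚ.*-zeroʳ 1/[1+ k ] ⟨
  1/[1+ k ] ℚ.* 0ℚ                          ≤⟨ ℚ.*-monoˡ-≤-nonNeg 1/[1+ k ] {{1/-nonNeg k}} (sum-nonneg _ λ s → Pr-nonneg P? (c s)) ⟩
  1/[1+ k ] ℚ.* Σℚ.sum (λ s → Pr P? (c s))  ∎
  where
  open ℚ.≤-Reasoning
  sum-nonneg : ∀ {l} (f : Vector ℚ l) → (∀ i → 0ℚ ℚ.≤ f i) → 0ℚ ℚ.≤ Σℚ.sum f
  sum-nonneg {zero}  f f≥0 = ℚ.≤-refl
  sum-nonneg {suc l} f f≥0 = ℚ.+-mono-≤ (f≥0 zero) (sum-nonneg (f ∘ suc) (f≥0 ∘ suc))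

-- Serves to transfer success of the remaining rounds to the execution with the current round put in
-- front.
Pr-map-mono : {X : Set a} {Y : Set b} {P : Pred X p} {Q : Pred Y q}
  (P? : Decidable P) (Q? : Decidable Q) (g : X → Y) → (∀ {x} → P x → Q (g x)) →
  (r : Rand X) → Pr P? r ℚ.≤ Pr Q? (r >>= λ x → return (g x))
Pr-map-mono P? Q? g P⇒Q (return x) with P? x | Q? (g x)
... | yes _  | yes _  = ℚ.≤-refl
... | yes Px | no ¬Qx = contradiction (P⇒Q Px) ¬Qx
... | no _   | yes _  = ℚ.nonNegative⁻¹ 1ℚ
... | no _   | no _   = ℚ.≤-refl
Pr-map-mono P? Q? g P⇒Q (uniform k c) = ℚ.*-monoˡ-≤-nonNeg 1/[1+ k ] {{1/-nonNeg k}}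
  (sumℚ-mono (λ s → Pr-map-mono P? Q? g P⇒Q (c s)))

-- Bounds on the probability of failure

-- For x > 0 this says that the complementary probability 1 - p is at most y / x.
record Bound (p : ℚ) (x y : ℕ) : Set where
  constructor mkBound
  field bound : ι x ℚ.≤ ι x ℚ.* p ℚ.+ ι y

bound-monoˡ : ∀ {p p′ x y} → p ℚ.≤ p′ → Bound p x y → Bound p′ x y
bound-monoˡ {x = x} {y} p≤p′ (mkBound bound) =
  mkBound (ℚ.≤-trans bound (ℚ.+-monoˡ-≤ (ι y) (ℚ.*-monoˡ-≤-nonNeg (ι x) {{ι-nonNeg x}} p≤p′)))

bound-monoʳ : ∀ {p x y y′} → y ≤ y′ → Bound p x y → Bound p x y′
bound-monoʳ {p} {x} y≤y′ (mkBound bound) =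
  mkBound (ℚ.≤-trans bound (ℚ.+-monoʳ-≤ (ι x ℚ.* p) (ι-mono y≤y′)))

bound-factor : ∀ p c x y → ι (c * x) ℚ.* p ℚ.+ ι (c * y) ≡ ι c ℚ.* (ι x ℚ.* p ℚ.+ ι y)
bound-factor p c x y = begin
  ι (c * x) ℚ.* p ℚ.+ ι (c * y)              ≡⟨ cong₂ (λ u v → u ℚ.* p ℚ.+ v) (ι-* c x) (ι-* c y) ⟩
  ι c ℚ.* ι x ℚ.* p ℚ.+ ι c ℚ.* ι y          ≡⟨ cong (ℚ._+ ι c ℚ.* ι y) (ℚ.*-assoc (ι c) (ι x) p) ⟩
  ι c ℚ.* (ι x ℚ.* p) ℚ.+ ι c ℚ.* ι y        ≡⟨ ℚ.*-distribˡ-+ (ι c) (ι x ℚ.* p) (ι y) ⟨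
  ι c ℚ.* (ι x ℚ.* p ℚ.+ ι y)                ∎
  where open ≡-Reasoning

bound-scale : ∀ {p x y} c → Bound p x y → Bound p (c * x) (c * y)
bound-scale {p} {x} {y} c (mkBound bound) = mkBound
  (subst₂ ℚ._≤_ (sym (ι-* c x)) (sym (bound-factor p c x y)) (ℚ.*-monoˡ-≤-nonNeg (ι c) {{ι-nonNeg c}} bound))

bound-cancel : ∀ {p} c x y .{{_ : NonZero c}} → Bound p (c * x) (c * y) → Bound p x y
bound-cancel {p} c@(suc c′) x y (mkBound bound) = mkBound
  (ℚ.*-cancelˡ-≤-pos (ι c) {{ι-pos c′}} (subst₂ ℚ._≤_ (ι-* c x) (bound-factor p c x y) bound))

bound-certain : ∀ {p x y} → p ≡ 1ℚ → Bound p x y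
bound-certain {x = x} {y} refl = mkBound (begin
  ι x                        ≤⟨ ι-mono (ℕ.m≤m+n x y) ⟩
  ι (x + y)                  ≡⟨ ι-+ x y ⟩
  ι x ℚ.+ ι y                ≡⟨ cong (ℚ._+ ι y) (ℚ.*-identityʳ (ι x)) ⟨
  ι x ℚ.* 1ℚ ℚ.+ ι y         ∎)
  where open ℚ.≤-Reasoning

bound-trivial : ∀ {p x y} → 0ℚ ℚ.≤ p → x ≤ y → Bound p x y
bound-trivial {p} {x} {y} p≥0 x≤y = mkBound (begin
  ι x                        ≤⟨ ι-mono x≤y ⟩
  ι y                        ≡⟨ ℚ.+-identityˡ (ι y) ⟨
  0ℚ ℚ.+ ι y                 ≡⟨ cong (ℚ._+ ι y) (ℚ.*-zeroʳ (ι x)) ⟨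
  ι x ℚ.* 0ℚ ℚ.+ ι y         ≤⟨ ℚ.+-monoˡ-≤ (ι y) (ℚ.*-monoˡ-≤-nonNeg (ι x) {{ι-nonNeg x}} p≥0) ⟩
  ι x ℚ.* p ℚ.+ ι y          ∎)
  where open ℚ.≤-Reasoning

-- The branches share the denominator `x`, so averaging their failure bounds adds the numerators and
-- multiplies the denominator by the number of branches.
bound-uniform : {X : Set a} {P : Pred X p} (P? : Decidable P) (c : Fin (suc k) → Rand X)
  (x : ℕ) (y : Vector ℕ (suc k)) → (∀ s → Bound (Pr P? (c s)) x (y s)) →
  Bound (Pr P? (uniform k c)) (suc k * x) (sum y)
bound-uniform {k = k} P? c x y bounds = mkBound (begin
  ι (suc k * x)
    ≡⟨ cong ι (sum-const (suc k) x) ⟨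
  ι (sum {suc k} (λ _ → x))
    ≡⟨ ι-sum {suc k} (λ _ → x) ⟨
  Σℚ.sum {suc k} (λ _ → ι x)
    ≤⟨ sumℚ-mono (Bound.bound ∘ bounds) ⟩
  Σℚ.sum (λ s → ι x ℚ.* Pr P? (c s) ℚ.+ ι (y s))
    ≡⟨ Σℚ.∑-distrib-+ (λ s → ι x ℚ.* Pr P? (c s)) (ι ∘ y) ⟩
  Σℚ.sum (λ s → ι x ℚ.* Pr P? (c s)) ℚ.+ Σℚ.sum (ι ∘ y)
    ≡⟨ cong₂ ℚ._+_ (sym (Σℚ.*-distribˡ-sum (ι x) (λ s → Pr P? (c s)))) (ι-sum y) ⟩
  ι x ℚ.* S ℚ.+ ι (sum y)
    ≡⟨ cong (ℚ._+ ι (sum y)) average ⟨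
  ι (suc k * x) ℚ.* (1/[1+ k ] ℚ.* S) ℚ.+ ι (sum y)
    ∎)
  where
  S = Σℚ.sum (λ s → Pr P? (c s))
  average : ι (suc k * x) ℚ.* (1/[1+ k ] ℚ.* S) ≡ ι x ℚ.* S
  average = let open ≡-Reasoning in begin
    ι (suc k * x) ℚ.* (1/[1+ k ] ℚ.* S)         ≡⟨ ℚ.*-assoc (ι (suc k * x)) 1/[1+ k ] S ⟨
    ι (suc k * x) ℚ.* 1/[1+ k ] ℚ.* S           ≡⟨ cong (λ z → z ℚ.* 1/[1+ k ] ℚ.* S) (trans (cong ι (ℕ.*-comm (suc k) x)) (ι-* x (suc k))) ⟩
    ι x ℚ.* ι (suc k) ℚ.* 1/[1+ k ] ℚ.* S       ≡⟨ cong (ℚ._* S) (ℚ.*-assoc (ι x) (ι (suc k)) 1/[1+ k ]) ⟩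
    ι x ℚ.* (ι (suc k) ℚ.* 1/[1+ k ]) ℚ.* S     ≡⟨ cong (λ z → ι x ℚ.* z ℚ.* S) (ι-inverse k) ⟩
    ι x ℚ.* 1ℚ ℚ.* S                            ≡⟨ cong (ℚ._* S) (ℚ.*-identityʳ (ι x)) ⟩
    ι x ℚ.* S                                   ∎
  open ℚ.≤-Reasoning

bound⇒≤ : ∀ {p} k x y .{{_ : NonZero x}} → suc k * y ≤ x → Bound p x y → 1ℚ ℚ.- 1/[1+ k ] ℚ.≤ p
bound⇒≤ {p} k x@(suc x′) y small bound = begin
  1ℚ ℚ.- 1/[1+ k ]                       ≤⟨ ℚ.+-monoˡ-≤ (ℚ.- 1/[1+ k ]) 1≤p+1/ ⟩
  p ℚ.+ 1/[1+ k ] ℚ.- 1/[1+ k ]          ≡⟨ ℚ.+-assoc p 1/[1+ k ] (ℚ.- 1/[1+ k ]) ⟩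
  p ℚ.+ (1/[1+ k ] ℚ.- 1/[1+ k ])        ≡⟨ cong (p ℚ.+_) (ℚ.+-inverseʳ 1/[1+ k ]) ⟩
  p ℚ.+ 0ℚ                               ≡⟨ ℚ.+-identityʳ p ⟩
  p                                      ∎
  where
  open ℚ.≤-Reasoning
  -- After scaling by `suc k` the numerator `suc k * y` may be raised to `x`, which then cancels and
  -- leaves the failure bound 1/(k + 1).
  normalised : Bound p (suc k) 1
  normalised = bound-cancel x (suc k) 1
    (bound-monoʳ (ℕ.≤-trans small (ℕ.≤-reflexive (sym (ℕ.*-identityʳ x))))
      (subst (λ z → Bound p z (suc k * y)) (ℕ.*-comm (suc k) x) (bound-scale (suc k) bound)))
  1≤p+1/ : 1ℚ ℚ.≤ p ℚ.+ 1/[1+ k ]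
  1≤p+1/ = ℚ.*-cancelˡ-≤-pos (ι (suc k)) {{ι-pos k}} (begin
    ι (suc k) ℚ.* 1ℚ                                   ≡⟨ ℚ.*-identityʳ (ι (suc k)) ⟩
    ι (suc k)                                          ≤⟨ Bound.bound normalised ⟩
    ι (suc k) ℚ.* p ℚ.+ ι 1                            ≡⟨ cong (ι (suc k) ℚ.* p ℚ.+_) (ι-inverse k) ⟨
    ι (suc k) ℚ.* p ℚ.+ ι (suc k) ℚ.* 1/[1+ k ]        ≡⟨ ℚ.*-distribˡ-+ (ι (suc k)) p 1/[1+ k ] ⟨
    ι (suc k) ℚ.* (p ℚ.+ 1/[1+ k ])                    ∎)

-- Phases and the effect of one round

𝟙-exclusive : (P? : Dec P) (Q? : Dec Q) (U? : Dec U) →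
  ¬ (P × Q) → ¬ (P × U) → ¬ (Q × U) → 𝟙 P? + 𝟙 Q? + 𝟙 U? ≤ 1
𝟙-exclusive (yes p) (yes q) _       ¬pq _   _   = contradiction (p , q) ¬pq
𝟙-exclusive (yes p) (no _)  (yes u) _   ¬pu _   = contradiction (p , u) ¬pu
𝟙-exclusive (yes _) (no _)  (no _)  _   _   _   = ℕ.≤-refl
𝟙-exclusive (no _)  (yes q) (yes u) _   _   ¬qu = contradiction (q , u) ¬qu
𝟙-exclusive (no _)  (yes _) (no _)  _   _   _   = ℕ.≤-refl
𝟙-exclusive (no _)  (no _)  U?      _   _   _   = 𝟙≤1 U?

-- Keeps a round from being charged to two phases. For phases 1 and 3 this rests on 2^M < 2^(12n) ≤
-- n^(12n), hence on `2 ≤ n`.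
phases-exclusive : ∀ n M → 2 ≤ n →
  𝟙 (inPhase? n phase₁ M) + 𝟙 (inPhase? n phase₂ M) + 𝟙 (inPhase? n phase₃ M) ≤ 1
phases-exclusive n M 2≤n = 𝟙-exclusive (inPhase? n phase₁ M) (inPhase? n phase₂ M) (inPhase? n phase₃ M)
  (λ (large , _ , small) → ℕ.<⇒≱ small large)
  (λ (large , small) → ℕ.<⇒≱
    (ℕ.<-≤-trans (ℕ.^-monoʳ-< 2 (s≤s (s≤s z≤n)) small) (ℕ.^-monoˡ-≤ (12 * n) 2≤n)) large)
  (λ ((large , _) , small) → ℕ.<⇒≱ small large)

-- `W` is a total over `q` outcomes, so W/q is an expected number of inversions, at most M d/(d + 1)
-- by the contraction.
contract-bound : ∀ {p} d q x y W M .{{_ : NonZero q}} → suc d * W + q * M ≤ suc d * (q * M) →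
  Bound p (q * x) (y * W) → Bound p (suc d * x) (d * y * M)
contract-bound {p} d q x y W M contraction bound =
  bound-cancel q (suc d * x) (d * y * M)
    (bound-monoʳ fewer
      (subst (λ z → Bound p z (suc d * (y * W))) (regroup₁ (suc d) q x) (bound-scale (suc d) bound)))
  where
  open ℕ.≤-Reasoning
  regroup₁ : ∀ D q x → D * (q * x) ≡ q * (D * x)
  regroup₁ = solve-∀
  regroup₂ : ∀ d q y M → y * (d * (q * M)) ≡ q * (d * y * M)
  regroup₂ = solve-∀
  contracted : suc d * W ≤ d * (q * M)
  contracted = ℕ.+-cancelʳ-≤ (q * M) (suc d * W) (d * (q * M))
    (ℕ.≤-trans contraction (ℕ.≤-reflexive (ℕ.+-comm (q * M) (d * (q * M)))))
  fewer : suc d * (y * W) ≤ q * (d * y * M)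
  fewer = begin
    suc d * (y * W)       ≡⟨ regroup₁ (suc d) y W ⟩
    y * (suc d * W)       ≤⟨ ℕ.*-monoʳ-≤ y contracted ⟩
    y * (d * (q * M))     ≡⟨ regroup₂ d q y M ⟩
    q * (d * y * M)       ∎

-- Executions and their probability of success

module Executions {c ℓ₁ ℓ₂} (O : StrictTotalOrder c ℓ₁ ℓ₂) (m : ℕ) where

  open SpinTheBottle O m
  open Inversions O m

  -- The assumed failure bound is linear in the number of inversions, so averaging it over the spins
  -- only replaces that number by its total over the outcomes.
  spins-bound : {X : Set a} {P : Pred X p} (P? : Decidable P) (f : Array → Rand X) (x y : ℕ) →
    (∀ B → Distinct B → Bound (Pr P? (f B)) x (y * inversions B)) →
    ∀ is A → Distinct A →
    Bound (Pr P? (spins is A >>= f)) (suc m ^ length is * x) (y * totalInversions is A)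
  spins-bound P? f x y bounds [] A distinct =
    subst (λ z → Bound (Pr P? (f A)) z (y * inversions A)) (sym (ℕ.*-identityˡ x)) (bounds A distinct)
  spins-bound P? f x y bounds (i ∷ is) A distinct =
    subst₂ (Bound (Pr P? (spins (i ∷ is) A >>= f)))
      (sym (ℕ.*-assoc (suc m) (suc m ^ length is) x)) (sym (*-distribˡ-sum y W))
      (bound-uniform P? (λ t → spins is (next t) >>= f) (suc m ^ length is * x) (λ t → y * W t)
        (λ t → spins-bound P? f x y bounds is (next t) (compareExchange-distinct i (punchIn i t) A distinct)))
    where
    next : Fin (suc m) → Array
    next t = compareExchange i (punchIn i t) A
    W : Fin (suc m) → ℕ
    W t = totalInversions is (next t)

  totalTime-∷ : ∀ A e → totalTime (execution (A ∷ starts e) (final e)) ≤ n + totalTime e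
  totalTime-∷ A e = ℕ.≤-trans
    (ℕ.≤-reflexive (cong₂ _+_ (cong₂ _+_ (split phase₁) (split phase₂)) (split phase₃)))
    (one-phase n (at phase₁) (at phase₂) (at phase₃) (count phase₁) (count phase₂) (count phase₃)
      (phases-exclusive n (inversions A) (s≤s (s≤s z≤n))))
    where
    at count : Phase → ℕ
    at ph    = 𝟙 (inPhase? n ph (inversions A))
    count ph = length (filter (λ B → inPhase? n ph (inversions B)) (starts e))
    split : ∀ ph → phaseTime ph (execution (A ∷ starts e) (final e)) ≡ n * (at ph + count ph)
    split ph = cong (n *_) (length-filter-∷ (λ B → inPhase? n ph (inversions B)) A (starts e))
    one-phase : ∀ n x y z a b c → x + y + z ≤ 1 →
      n * (x + a) + n * (y + b) + n * (z + c) ≤ n + (n * a + n * b + n * c)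
    one-phase n x y z a b c x+y+z≤1 = begin
      n * (x + a) + n * (y + b) + n * (z + c)          ≡⟨ regroup n x y z a b c ⟩
      n * (x + y + z) + (n * a + n * b + n * c)        ≤⟨ ℕ.+-monoˡ-≤ _ (ℕ.*-monoʳ-≤ n x+y+z≤1) ⟩
      n * 1 + (n * a + n * b + n * c)                  ≡⟨ cong (_+ (n * a + n * b + n * c)) (ℕ.*-identityʳ n) ⟩
      n + (n * a + n * b + n * c)                      ∎
      where
      open ℕ.≤-Reasoning
      regroup : ∀ n x y z a b c → n * (x + a) + n * (y + b) + n * (z + c) ≡
                n * (x + y + z) + (n * a + n * b + n * c)
      regroup = solve-∀

  success-[] : ∀ T A → Sorted A → Success T (execution [] A)
  success-[] T A sorted = sorted , ℕ.≤-trans (ℕ.≤-reflexive (no-time n)) z≤n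
    where
    no-time : ∀ n → n * 0 + n * 0 + n * 0 ≡ 0
    no-time = solve-∀

  success-∷ : ∀ {T T′} A {e} → n + T′ ≤ T → Success T′ e → Success T (execution (A ∷ starts e) (final e))
  success-∷ A {e} n+T′≤T (sorted , time) =
    sorted , ℕ.≤-trans (totalTime-∷ A e) (ℕ.≤-trans (ℕ.+-monoʳ-≤ n time) n+T′≤T)

  Pr-sorted : ∀ T A → Sorted A → Pr (success? T) (return (execution [] A)) ≡ 1ℚ
  Pr-sorted T A sorted = cong (λ b → if b then 1ℚ else 0ℚ) (dec-true (success? T (execution [] A)) (success-[] T A sorted))

  -- Only `r` rounds are made to contract, while the loop may be interrupted as late as `F`, since
  -- in the application `F` is the whole time budget. In the induction the rest receives exactly the
  -- budget `n * r`.
  execution-bound : ∀ d → suc d ≡ 12 * n → ∀ r F T A → Distinct A → r ≤ F → n * r ≤ T →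
    Bound (Pr (success? T) (spinTheBottle F A)) (suc d ^ r) (d ^ r * inversions A)
  execution-bound d D≡ zero F T A distinct _ _ = decide (sorted? A)
    where
    certain : Sorted A → ∀ F → Pr (success? T) (spinTheBottle F A) ≡ 1ℚ
    certain sorted zero    = Pr-sorted T A sorted
    certain sorted (suc F) = if-elim (sorted? A) (λ e → Pr (success? T) e ≡ 1ℚ)
      (λ _ → Pr-sorted T A sorted) (contradiction sorted)
    -- Markov's inequality: an unsorted array of distinct elements has an inversion, so the
    -- indicator of failure is at most M.
    decide : Dec (Sorted A) → Bound (Pr (success? T) (spinTheBottle F A)) 1 (1 * inversions A)
    decide (yes sorted)  = bound-certain (certain sorted F)
    decide (no unsorted) = bound-trivial (Pr-nonneg (success? T) (spinTheBottle F A))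
      (ℕ.≤-trans (unsorted⇒0<inversions A distinct unsorted)
                 (ℕ.≤-reflexive (sym (ℕ.*-identityˡ (inversions A)))))
  execution-bound d D≡ (suc r) (suc F) T A distinct (s≤s r≤F) n+nr≤T =
    if-elim (sorted? A) (λ e → Bound (Pr (success? T) e) (suc d ^ suc r) (d ^ suc r * inversions A))
      (λ sorted → bound-certain (Pr-sorted T A sorted))
      (λ _ → after-round)
    where
    rest : Array → Rand Execution
    rest B = spinTheBottle F B >>= λ e → return (execution (A ∷ starts e) (final e))
    pr = Pr (success? T) (round A >>= rest)
    M = inversions A
    W = totalInversions (allFin n) A
    Nⁿ = suc m ^ n
    n*r+n≤T : n + n * r ≤ T
    n*r+n≤T = ℕ.≤-trans (ℕ.≤-reflexive (sym (ℕ.*-suc n r))) n+nr≤T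
    rest-bound : ∀ B → Distinct B → Bound (Pr (success? T) (rest B)) (suc d ^ r) (d ^ r * inversions B)
    rest-bound B distinct′ = bound-monoˡ
      (Pr-map-mono (success? (n * r)) (success? T) (λ e → execution (A ∷ starts e) (final e))
        (λ {e} → success-∷ A {e} n*r+n≤T) (spinTheBottle F B))
      (execution-bound d D≡ r F (n * r) B distinct′ r≤F ℕ.≤-refl)
    round-bound : Bound pr (Nⁿ * suc d ^ r) (d ^ r * W)
    round-bound = subst (λ l → Bound pr (suc m ^ l * suc d ^ r) (d ^ r * W))
      (List.length-tabulate {n = n} (λ i → i))
      (spins-bound (success? T) rest (suc d ^ r) (d ^ r) rest-bound (allFin n) A distinct)
    after-round : Bound pr (suc d ^ suc r) (d ^ suc r * M)
    after-round = contract-bound d Nⁿ (suc d ^ r) (d ^ r) W M {{ℕ.m^n≢0 (suc m) n}}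
      (subst (λ D → D * W + Nⁿ * M ≤ D * (Nⁿ * M)) (sym D≡) (round-contraction O m A)) round-bound

-- The number of rounds

*-^-mono : ∀ {x y z} → x * y ≤ z → ∀ t → x ^ t * y ^ t ≤ z ^ t
*-^-mono xy≤z zero    = ℕ.≤-refl
*-^-mono {x} {y} {z} xy≤z (suc t) = begin
  x * x ^ t * (y * y ^ t)    ≡⟨ regroup x y (x ^ t) (y ^ t) ⟩
  x * y * (x ^ t * y ^ t)    ≤⟨ ℕ.*-mono-≤ xy≤z (*-^-mono xy≤z t) ⟩
  z * z ^ t                  ∎
  where
  open ℕ.≤-Reasoning
  regroup : ∀ x y p q → x * p * (y * q) ≡ x * y * (p * q)
  regroup = solve-∀

-- Every `suc d` rounds halve the bound, and 6L halvings divide it by at least n³: n² for the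
-- initial inversions and n for the probability of failure.
enough-rounds : ∀ n d L M → .{{NonZero d}} → M ≤ n * n → n ≤ 2 ^ (2 * L) →
  let R = suc d * (2 * L * 3) in n * (d ^ R * M) ≤ suc d ^ R
enough-rounds n d L M M≤n² n≤2^2L = begin
  n * (d ^ (suc d * t) * M)              ≡⟨ regroup n (d ^ (suc d * t)) M ⟩
  d ^ (suc d * t) * (n * M)              ≤⟨ ℕ.*-monoʳ-≤ (d ^ (suc d * t)) (ℕ.*-monoʳ-≤ n M≤n²) ⟩
  d ^ (suc d * t) * (n * (n * n))        ≡⟨ cong (λ z → d ^ (suc d * t) * (n * (n * z))) (ℕ.*-identityʳ n) ⟨
  d ^ (suc d * t) * n ^ 3                ≤⟨ ℕ.*-monoʳ-≤ (d ^ (suc d * t)) (ℕ.^-monoˡ-≤ 3 n≤2^2L) ⟩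
  d ^ (suc d * t) * (2 ^ (2 * L)) ^ 3    ≡⟨ cong₂ _*_ (sym (ℕ.^-*-assoc d (suc d) t)) (ℕ.^-*-assoc 2 (2 * L) 3) ⟩
  (d ^ suc d) ^ t * 2 ^ t                ≤⟨ *-^-mono (d^[1+d]*2≤[1+d]^[1+d] d) t ⟩
  (suc d ^ suc d) ^ t                    ≡⟨ ℕ.^-*-assoc (suc d) (suc d) t ⟩
  suc d ^ (suc d * t)                    ∎
  where
  open ℕ.≤-Reasoning
  t = 2 * L * 3
  regroup : ∀ n y M → n * (y * M) ≡ y * (n * M)
  regroup = solve-∀

-- Doubling the logarithm absorbs its rounding down, because 1 + L ≤ 2L once L ≥ 1.
n≤2^[2*⌊log₂n⌋] : ∀ n → 2 ≤ n → n ≤ 2 ^ (2 * ⌊log₂ n ⌋)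
n≤2^[2*⌊log₂n⌋] n 2≤n = ℕ.≤-trans (ℕ.<⇒≤ (n<2^[1+⌊log₂n⌋] n))
  (ℕ.^-monoʳ-≤ 2 (double ⌊log₂ n ⌋ (⌊log₂⌋-mono-≤ 2≤n)))
  where
  double : ∀ L → 1 ≤ L → suc L ≤ 2 * L
  double L 1≤L = ℕ.+-mono-≤ 1≤L (ℕ.m≤m+n L 0)

1/n^1 : ∀ k → 1/ suc k ^ 1 ≡ 1/[1+ k ]
1/n^1 k = ℚ./-cong {p₁ = ℤ.+ 1} {{ℕ.m^n≢0 (suc k) 1}} {{_}} refl (ℕ.*-identityʳ (suc k))

successProbability-bound : ∀ {c ℓ₁ ℓ₂} (O : StrictTotalOrder c ℓ₁ ℓ₂) m → let open SpinTheBottle O m in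
  ∀ L T d A → Distinct A → suc d ≡ 12 * n → n ≤ 2 ^ (2 * L) → n * (suc d * (2 * L * 3)) ≤ T →
  1ℚ ℚ.- (1/ n ^ 1) ℚ.≤ successProbability T A
successProbability-bound O m L T d A distinct D≡ n≤2^2L nR≤T =
  subst (λ z → 1ℚ ℚ.- z ℚ.≤ successProbability T A) (sym (1/n^1 (suc m)))
    (bound⇒≤ (suc m) (suc d ^ R) (d ^ R * inversions A) {{ℕ.m^n≢0 (suc d) R}}
      (enough-rounds n d L (inversions A) {{d≢0 d D≡}} (inversions≤n*n A) n≤2^2L)
      (execution-bound d D≡ R T T A distinct (ℕ.≤-trans (ℕ.m≤n*m R n) nR≤T) nR≤T))
  where
  open SpinTheBottle O m
  open Inversions O m
  open Executions O m
  R = suc d * (2 * L * 3)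
  d≢0 : ∀ d → suc d ≡ 12 * n → NonZero d
  d≢0 (suc _) _ = _

theorem2p2 : (c ℓ₁ ℓ₂ : Level) →
    ∃[ C ] ∃[ ρ ] (1 ≤ ρ ×
    ((O : StrictTotalOrder c ℓ₁ ℓ₂) (m : ℕ) →
    let open SpinTheBottle O m in
    (A : Array) → Distinct A →
    1ℚ ℚ.- (1/ n ^ ρ) ℚ.≤ successProbability (C * (n * n * ⌊log₂ n ⌋)) A))
-- 72 is 12 · 6: a halving takes `12 * n` rounds of `n` operations each, and `6 * L` halvings are
-- made.
theorem2p2 c ℓ₁ ℓ₂ = 72 , 1 , ℕ.≤-refl , λ O m A distinct →
  let open SpinTheBottle O m in let L = ⌊log₂ n ⌋ in
  successProbability-bound O m L (72 * (n * n * L)) (pred (12 * n)) A distinct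
    (ℕ.suc-pred (12 * n)) (n≤2^[2*⌊log₂n⌋] n (s≤s (s≤s z≤n)))
    (ℕ.≤-reflexive (time n L))
  where
  time : ∀ n L → n * (12 * n * (2 * L * 3)) ≡ 72 * (n * n * L)
  time = solve-∀
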